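{- There exist infinitely many $2$-layer $4$-planar graphs with $n$ vertices and $2n-3$ edges; that is, for infinitely many values of $n$ there is a $2$-layer $4$-planar graph with exactly $n$ vertices and exactly $2n-3$ edges.
   Context: All graphs are finite and simple (no loops or parallel edges). A topological $2$-layer graph is a bipartite graph $G=(U\,\dot\cup\,V,E)$, $E\subseteq U\times V$, drawn in the plane so that the vertices of $U$ and of $V$ are distinct points on two horizontal lines $L_u$ and $L_v$, respectively, and edges are $y$-monotone Jordan arcs; the drawing is assumed simple, i.e. adjacent edges do not cross and independent edges cross at most once. Denote the vertices by $u_1,\dots,u_p$ along $L_u$ and $v_1,\dots,v_q$ along $L_v$ in left-to-right order, $n=p+q$. (Thus edges $(u_i,v_x)$ and $(u_j,v_y)$ with $i<j$ cross if and only if $x>y$.) A topological $2$-layer graph is $k$-planar if each edge is crossed at most $k$ times. A bipartite graph is $2$-layer $k$-planar if it is isomorphic to the underlying abstract graph of some topological $2$-layer $k$-planar graph. -}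

module Defs where

open import Data.Nat using (ℕ; _+_; _≤_)
open import Data.Fin using (Fin; _<_; splitAt)
open import Data.Fin.Properties using (_<?_)
open import Data.List using (List; length; filter; cartesianProduct; allFin)
open import Data.Product using (_×_; _,_; ∃-syntax)
open import Data.Sum using (_⊎_; inj₁; inj₂)
open import Data.Empty using (⊥)
open import Function.Bundles using (_↔_; _⇔_; module Inverse)
open import Level using (0ℓ)
open import Relation.Binary.Core using (Rel; REL)
open import Relation.Binary.Definitions using (Decidable; Symmetric)
open import Relation.Nullary using (¬_; no)
open import Relation.Nullary.Decidable using (_×-dec_; _⊎-dec_)

record Graph (n : ℕ) : Set₁ where
  field
    Adj    : Rel (Fin n) 0ℓ
    adj?   : Decidable Adj
    symm   : Symmetric Adj
    irrefl : ∀ x → ¬ Adj x x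

-- Each undirected edge is counted once, as the pair (x , y) with x < y.
size : ∀ {n} → Graph n → ℕ
size {n} G =
  length (filter (λ (x , y) → (x <? y) ×-dec adj? x y)
                 (cartesianProduct (allFin n) (allFin n)))
  where open Graph G

record _≅_ {m n : ℕ} (G : Graph m) (H : Graph n) : Set where
  private
    module G = Graph G
    module H = Graph H
  field
    bijection : Fin m ↔ Fin n
    adj-iff   : ∀ x y → G.Adj x y ⇔ H.Adj (Inverse.to bijection x) (Inverse.to bijection y)

-- A topological 2-layer graph, recorded by the left-to-right orders of its
-- two layers (Fin p on L_u, Fin q on L_v) and its edge set.  In a simple
-- drawing with y-monotone edges these data determine which edges cross:
-- exactly those whose endpoints are oppositely ordered on the two layers.
record TwoLayerGraph : Set₁ where
  field
    p q   : ℕ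
    Edge  : REL (Fin p) (Fin q) 0ℓ
    edge? : Decidable Edge

Crosses : ∀ {p q} → Rel (Fin p × Fin q) 0ℓ
Crosses (i , x) (j , y) = (i < j × y < x) ⊎ (j < i × x < y)

crosses? : ∀ {p q} → Decidable (Crosses {p} {q})
crosses? (i , x) (j , y) = ((i <? j) ×-dec (y <? x)) ⊎-dec ((j <? i) ×-dec (x <? y))

module _ (D : TwoLayerGraph) where
  open TwoLayerGraph D

  edges : List (Fin p × Fin q)
  edges = filter (λ (i , x) → edge? i x) (cartesianProduct (allFin p) (allFin q))

  crossings : Fin p × Fin q → ℕ
  crossings e = length (filter (crosses? e) edges)

  IsKPlanar : ℕ → Set
  IsKPlanar k = ∀ i x → Edge i x → crossings (i , x) ≤ k

  LayerAdj : Rel (Fin p ⊎ Fin q) 0ℓ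
  LayerAdj (inj₁ i) (inj₂ x) = Edge i x
  LayerAdj (inj₂ x) (inj₁ i) = Edge i x
  LayerAdj (inj₁ _) (inj₁ _) = ⊥
  LayerAdj (inj₂ _) (inj₂ _) = ⊥

  layerAdj? : Decidable LayerAdj
  layerAdj? (inj₁ i) (inj₂ x) = edge? i x
  layerAdj? (inj₂ x) (inj₁ i) = edge? i x
  layerAdj? (inj₁ _) (inj₁ _) = no λ ()
  layerAdj? (inj₂ _) (inj₂ _) = no λ ()

  layerAdj-sym : Symmetric LayerAdj
  layerAdj-sym {inj₁ _} {inj₂ _} e = e
  layerAdj-sym {inj₂ _} {inj₁ _} e = e

  layerAdj-irrefl : ∀ a → ¬ LayerAdj a a
  layerAdj-irrefl (inj₁ _) ()
  layerAdj-irrefl (inj₂ _) ()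

  underlying : Graph (p + q)
  underlying = record
    { Adj    = λ a b → LayerAdj (splitAt p a) (splitAt p b)
    ; adj?   = λ a b → layerAdj? (splitAt p a) (splitAt p b)
    ; symm   = λ {a} {b} → layerAdj-sym {splitAt p a} {splitAt p b}
    ; irrefl = λ a → layerAdj-irrefl (splitAt p a)
    }

TwoLayerKPlanar : ∀ {n} → ℕ → Graph n → Set₁
TwoLayerKPlanar k G = ∃[ D ] IsKPlanar D k × G ≅ underlying D

{-# OPTIONS --safe #-}
-- In the straight-line drawing of K₃,₃ every edge is crossed at most four times.
-- Chain t such drawings, letting the last edge (u₃ , v₃) of each block be the first
-- edge (u₁ , v₁) of the next.  Edges of different blocks are weakly ordered the same
-- way on both layers, so they do not cross and the drawing stays 4-planar.  Each
-- block after the first brings four vertices and eight edges, which preserves the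
-- relation 9 = 2 · 6 − 3 that holds for K₃,₃.
module Submission where

open import Defs
open import Data.Fin as Fin using (Fin; zero; suc; toℕ; fromℕ<; splitAt; _↑ˡ_; _↑ʳ_; combine; remQuot; inject₁)
open import Data.Fin.Patterns using (0F; 2F; 7F)
open import Data.Fin.Properties as Fin using
  ( toℕ-fromℕ<; toℕ-injective; toℕ<n; toℕ≤pred[n]; toℕ-inject₁; toℕ-↑ˡ; toℕ-↑ʳ
  ; splitAt-↑ˡ; splitAt-↑ʳ; splitAt⁻¹-↑ˡ; splitAt⁻¹-↑ʳ; ↑ˡ-injective; ↑ʳ-injective
  ; remQuot-combine; combine-remQuot; any?; all? )
open import Data.List using (List; []; _∷_; length; map; filter; cartesianProduct; allFin; _++_)
open import Data.List.Properties using (length-map; length-++; length-tabulate)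
open import Data.List.Membership.Propositional using (_∈_)
open import Data.List.Membership.Propositional.Properties using
  (∈-∃++; ∈-filter⁺; ∈-filter⁻; ∈-cartesianProduct⁺; ∈-allFin; ∈-map⁺; ∈-map⁻)
open import Data.List.Relation.Binary.Permutation.Propositional.Properties using (∈-resp-↭; ↭-length; shift)
open import Data.List.Relation.Binary.Subset.Propositional using (_⊆_)
import Data.List.Relation.Unary.All as All
open import Data.List.Relation.Unary.AllPairs using ([]; _∷_)
open import Data.List.Relation.Unary.Any using (here; there)
open import Data.List.Relation.Unary.Unique.Propositional using (Unique)
import Data.List.Relation.Unary.Unique.Propositional.Properties as Unique
open import Data.Nat using (ℕ; suc; _+_; _*_; _<_; _≤_; z≤n; s≤s; _≤?_)
open import Data.Nat.Properties as ℕ using (≤-trans; ≤-antisym; module ≤-Reasoning)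
open import Data.Nat.Tactic.RingSolver using (solve-∀)
open import Data.Product using (_×_; _,_; Σ-syntax; ∃-syntax; proj₁; proj₂; uncurry)
open import Data.Product.Properties using (,-injective)
open import Data.Sum using (_⊎_; inj₁; inj₂)
open import Function using (id)
open import Function.Construct.Identity using (↔-id; ⇔-id)
open import Relation.Binary.Definitions using (tri<; tri≈; tri>)
open import Relation.Binary.PropositionalEquality using (_≡_; _≢_; refl; sym; trans; cong; cong₂; subst; subst₂; module ≡-Reasoning)
open import Relation.Nullary using (¬_; contradiction)
open import Relation.Nullary.Decidable using (toWitness; _×-dec_)

-- Counting with duplicate-free lists

-- Cut `ys` at an occurrence of the head `x`; the tail of `xs` avoids `x`, so it stays inside
-- `as ++ bs`, which is shorter by one. All later counts of edges and crossings rest on such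
-- inclusions.
Unique-⊆-length : ∀ {A : Set} {xs ys : List A} → Unique xs → xs ⊆ ys → length xs ≤ length ys
Unique-⊆-length [] _ = z≤n
Unique-⊆-length {xs = x ∷ xs} (x∉xs ∷ xs!) sub
  with as , bs , refl ← ∈-∃++ (sub (here refl)) =
  subst (suc (length xs) ≤_) (sym (↭-length (shift x as bs))) (s≤s (Unique-⊆-length xs! sub′))
  where
  sub′ : xs ⊆ as ++ bs
  sub′ z∈xs with ∈-resp-↭ (shift x as bs) (sub (there z∈xs))
  ... | here z≡x = contradiction (sym z≡x) (All.lookup x∉xs z∈xs)
  ... | there z∈ = z∈

allPairs-unique : ∀ m n → Unique (cartesianProduct (allFin m) (allFin n))
allPairs-unique m n = Unique.cartesianProduct⁺ (Unique.allFin⁺ m) (Unique.allFin⁺ n)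

∈-allPairs : ∀ {m n} (e : Fin m × Fin n) → e ∈ cartesianProduct (allFin m) (allFin n)
∈-allPairs (i , x) = ∈-cartesianProduct⁺ (∈-allFin i) (∈-allFin x)

length-cartesianProduct : ∀ {A B : Set} (xs : List A) (ys : List B) → length (cartesianProduct xs ys) ≡ length xs * length ys
length-cartesianProduct []       ys = refl
length-cartesianProduct (x ∷ xs) ys = trans (length-++ (map (x ,_) ys))
  (cong₂ _+_ (length-map (x ,_) ys) (length-cartesianProduct xs ys))

length-allPairs : ∀ m n → length (cartesianProduct (allFin m) (allFin n)) ≡ m * n
length-allPairs m n = trans (length-cartesianProduct (allFin m) (allFin n))
  (cong₂ _*_ (length-tabulate {n = m} id) (length-tabulate {n = n} id))

-- Size of the underlying graph

module _ (D : TwoLayerGraph) where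
  open TwoLayerGraph D

  edges-unique : Unique (edges D)
  edges-unique = Unique.filter⁺ (λ (i , x) → edge? i x) (allPairs-unique p q)

  ∈-edges⁺ : ∀ {e} → uncurry Edge e → e ∈ edges D
  ∈-edges⁺ {e} = ∈-filter⁺ (λ (i , x) → edge? i x) (∈-allPairs e)

  ∈-edges⁻ : ∀ {e} → e ∈ edges D → uncurry Edge e
  ∈-edges⁻ e∈ = proj₂ (∈-filter⁻ (λ (i , x) → edge? i x) {xs = cartesianProduct (allFin p) (allFin q)} e∈)

  private
    open Graph (underlying D) using (Adj; adj?)

    inject : Fin p × Fin q → Fin (p + q) × Fin (p + q)
    inject (i , x) = i ↑ˡ q , p ↑ʳ x

    inject-injective : ∀ {e f} → inject e ≡ inject f → e ≡ f
    inject-injective eq with eq₁ , eq₂ ← ,-injective eq =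
      cong₂ _,_ (↑ˡ-injective q _ _ eq₁) (↑ʳ-injective p _ _ eq₂)

    inject-< : ∀ (i : Fin p) (x : Fin q) → i ↑ˡ q Fin.< p ↑ʳ x
    inject-< i x = subst₂ _<_ (sym (toℕ-↑ˡ i q)) (sym (toℕ-↑ʳ p x)) (ℕ.<-≤-trans (toℕ<n i) (ℕ.m≤m+n p (toℕ x)))

    adj⁺ : ∀ {i x} → Edge i x → Adj (i ↑ˡ q) (p ↑ʳ x)
    adj⁺ {i} {x} e rewrite splitAt-↑ˡ p i q | splitAt-↑ʳ p q x = e

    -- The vertices of the first layer are numbered before those of the second, so an adjacent pair
    -- in increasing order must start on the first layer.
    adj⁻ : ∀ {a b} → a Fin.< b → Adj a b → ∃[ e ] uncurry Edge e × (a , b) ≡ inject e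
    adj⁻ {a} {b} a<b adj with splitAt p a in eqa | splitAt p b in eqb
    ... | inj₁ i | inj₂ x = (i , x) , adj , cong₂ _,_ (sym (splitAt⁻¹-↑ˡ eqa)) (sym (splitAt⁻¹-↑ʳ {p} eqb))
    ... | inj₂ x | inj₁ i = contradiction
      (subst₂ Fin._<_ (sym (splitAt⁻¹-↑ʳ {p} eqa)) (sym (splitAt⁻¹-↑ˡ eqb)) a<b)
      (ℕ.<-asym (inject-< i x))

    orderedAdj? = λ ((x , y) : Fin (p + q) × Fin (p + q)) → (x Fin.<? y) ×-dec adj? x y

    orderedPairs = cartesianProduct (allFin (p + q)) (allFin (p + q))

  -- `inject` matches the edges of the drawing with the increasing adjacent pairs; inclusions in
  -- both directions give the two inequalities.
  size-underlying : size (underlying D) ≡ length (edges D)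
  size-underlying = trans
    (≤-antisym
      (Unique-⊆-length (Unique.filter⁺ orderedAdj? (allPairs-unique (p + q) (p + q))) to)
      (Unique-⊆-length (Unique.map⁺ inject-injective edges-unique) from))
    (length-map inject (edges D))
    where
    to : filter orderedAdj? orderedPairs ⊆ map inject (edges D)
    to e∈ with _ , a<b , adj ← ∈-filter⁻ orderedAdj? {xs = orderedPairs} e∈
      with _ , edge , refl ← adj⁻ a<b adj = ∈-map⁺ inject (∈-edges⁺ edge)

    from : map inject (edges D) ⊆ filter orderedAdj? orderedPairs
    from e∈ with (i , x) , f∈ , refl ← ∈-map⁻ inject e∈ =
      ∈-filter⁺ orderedAdj? (∈-allPairs _) (inject-< i x , adj⁺ (∈-edges⁻ f∈))

≅-refl : ∀ {n} (G : Graph n) → G ≅ G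
≅-refl {n} G = record { bijection = ↔-id (Fin n) ; adj-iff = λ x y → ⇔-id (Graph.Adj G x y) }

-- Positions of the blocks

block-end : ∀ {b c} → b < c → b * 2 + 2 ≤ c * 2
block-end {b} {c} b<c = subst (_≤ c * 2) (ℕ.+-comm 2 (b * 2)) (ℕ.*-monoˡ-≤ 2 b<c)

opaque
  -- The stride is 2 while a block has 3 positions on a layer, so consecutive blocks share exactly
  -- one.
  embed : ∀ {t} → Fin t → Fin 3 → Fin (suc (t * 2))
  embed {t} b r = fromℕ< {toℕ b * 2 + toℕ r}
    (s≤s (≤-trans (ℕ.+-monoʳ-≤ (toℕ b * 2) (toℕ≤pred[n] r)) (block-end (toℕ<n b))))

  toℕ-embed : ∀ {t} (b : Fin t) r → toℕ (embed b r) ≡ toℕ b * 2 + toℕ r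
  toℕ-embed b r = toℕ-fromℕ< _

embed-cancel-< : ∀ {t} (b : Fin t) {r s} → embed b r Fin.< embed b s → r Fin.< s
embed-cancel-< b {r} {s} lt = ℕ.+-cancelˡ-< (toℕ b * 2) _ _ (subst₂ _<_ (toℕ-embed b r) (toℕ-embed b s) lt)

embed-injective : ∀ {t} (b : Fin t) {r s} → embed b r ≡ embed b s → r ≡ s
embed-injective b {r} {s} eq = toℕ-injective (ℕ.+-cancelˡ-≡ (toℕ b * 2) _ _
  (trans (sym (toℕ-embed b r)) (trans (cong toℕ eq) (toℕ-embed b s))))

-- Block `b` ends at or before the start of block `c`. Dropping the summand `toℕ s` yields the weak
-- order of blocks; keeping it forces `s` to be `0F` where two blocks meet.
embed-gap : ∀ {t} {b c : Fin t} → b Fin.< c → ∀ r s → toℕ (embed b r) + toℕ s ≤ toℕ (embed c s)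
embed-gap {b = b} {c} b<c r s = begin
  toℕ (embed b r) + toℕ s         ≡⟨ cong (_+ toℕ s) (toℕ-embed b r) ⟩
  toℕ b * 2 + toℕ r + toℕ s       ≤⟨ ℕ.+-monoˡ-≤ (toℕ s) (ℕ.+-monoʳ-≤ (toℕ b * 2) (toℕ≤pred[n] r)) ⟩
  toℕ b * 2 + 2 + toℕ s           ≤⟨ ℕ.+-monoˡ-≤ (toℕ s) (block-end b<c) ⟩
  toℕ c * 2 + toℕ s               ≡⟨ toℕ-embed c s ⟨
  toℕ (embed c s)                 ∎
  where open ≤-Reasoning

embed-mono-≤ : ∀ {t} {b c : Fin t} → b Fin.< c → ∀ r s → embed b r Fin.≤ embed c s
embed-mono-≤ b<c r s = ≤-trans (ℕ.m≤m+n _ (toℕ s)) (embed-gap b<c r s)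

embed-overlap : ∀ {t} {b c : Fin t} → b Fin.< c → ∀ {r s} → embed b r ≡ embed c s → s ≡ 0F
embed-overlap {c = c} b<c {r} {s} eq = toℕ-injective (ℕ.n≤0⇒n≡0 (ℕ.+-cancelˡ-≤ (toℕ (embed c s)) _ _
  (subst₂ _≤_ (cong (λ i → toℕ i + toℕ s) eq) (sym (ℕ.+-identityʳ _)) (embed-gap b<c r s))))

embed-zero : ∀ {t} (b : Fin t) {r} → embed b r ≡ zero → r ≡ 0F
embed-zero b {r} eq = toℕ-injective (ℕ.m+n≡0⇒n≡0 (toℕ b * 2) (trans (sym (toℕ-embed b r)) (cong toℕ eq)))

embed-origin : ∀ {t} → zero ≡ embed {suc t} zero 0F
embed-origin = toℕ-injective (sym (toℕ-embed zero 0F))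

embed-shared : ∀ {t} (b : Fin t) → embed (suc b) 0F ≡ embed (inject₁ b) 2F
embed-shared b = toℕ-injective (trans (toℕ-embed (suc b) 0F)
  (trans (arith (toℕ b)) (sym (trans (toℕ-embed (inject₁ b) 2F) (cong (λ k → k * 2 + 2) (toℕ-inject₁ b))))))
  where
  arith : ∀ k → suc k * 2 + 0 ≡ k * 2 + 2
  arith = solve-∀

embedEdge : ∀ {t} → Fin t → Fin 3 × Fin 3 → Fin (suc (t * 2)) × Fin (suc (t * 2))
embedEdge b (r , s) = embed b r , embed b s

-- Since edges form a relation, an edge shared by two blocks has two witnesses but is listed once.
chain : ℕ → TwoLayerGraph
chain t = record
  { p     = suc (t * 2)
  ; q     = suc (t * 2)
  ; Edge  = λ i x → ∃[ b ] ∃[ r ] ∃[ s ] (i ≡ embed {t} b r × x ≡ embed {t} b s)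
  ; edge? = λ i x → any? λ b → any? λ r → any? λ s → (i Fin.≟ embed b r) ×-dec (x Fin.≟ embed b s)
  }

-- Crossings stay inside a block

-- A crossing needs a strict inversion on each layer, and the weak order of the blocks already
-- excludes one, even where they share vertices.
blocks-noncrossing : ∀ {t} {b c : Fin t} → b Fin.< c → ∀ e f → ¬ Crosses (embedEdge b e) (embedEdge c f)
blocks-noncrossing b<c (_ , s) (_ , s′) (inj₁ (_ , y<x)) = ℕ.<⇒≱ y<x (embed-mono-≤ b<c s s′)
blocks-noncrossing b<c (r , _) (r′ , _) (inj₂ (j<i , _)) = ℕ.<⇒≱ j<i (embed-mono-≤ b<c r r′)

Crosses-sym : ∀ {p q} {e f : Fin p × Fin q} → Crosses e f → Crosses f e
Crosses-sym (inj₁ c) = inj₂ c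
Crosses-sym (inj₂ c) = inj₁ c

-- This holds for any choice of blocks containing the two edges, so shared edges need no separate
-- treatment.
crossing-in-block : ∀ {t} {b c : Fin t} e f → Crosses (embedEdge b e) (embedEdge c f) → b ≡ c × Crosses e f
crossing-in-block {b = b} {c} e f cr with Fin.<-cmp b c
... | tri< b<c _ _ = contradiction cr (blocks-noncrossing b<c e f)
... | tri> _ _ c<b = contradiction (Crosses-sym {e = embedEdge b e} {f = embedEdge c f} cr) (blocks-noncrossing c<b f e)
... | tri≈ _ refl _ with cr
...   | inj₁ (i<j , y<x) = refl , inj₁ (embed-cancel-< b i<j , embed-cancel-< b y<x)
...   | inj₂ (j<i , x<y) = refl , inj₂ (embed-cancel-< b j<i , embed-cancel-< b x<y)

-- Opaque, since unfolding the filter at a variable edge branches on nine stuck decisions.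
opaque
  K₃,₃-crossing : Fin 3 × Fin 3 → List (Fin 3 × Fin 3)
  K₃,₃-crossing e = filter (crosses? e) (cartesianProduct (allFin 3) (allFin 3))

  ∈-K₃,₃-crossing : ∀ e f → Crosses e f → f ∈ K₃,₃-crossing e
  ∈-K₃,₃-crossing e f = ∈-filter⁺ (crosses? e) (∈-allPairs f)

  K₃,₃-4-planar : ∀ r s → length (K₃,₃-crossing (r , s)) ≤ 4
  K₃,₃-4-planar = toWitness {a? = all? λ r → all? λ s → length (K₃,₃-crossing (r , s)) ≤? 4} _

-- All edges that cross an edge of block `b` are images under `embedEdge b` of edges that cross its
-- preimage in K₃,₃, so the bound for K₃,₃ carries over.
chain-4-planar : ∀ t → IsKPlanar (chain t) 4
chain-4-planar t i x (b , r , s , refl , refl) = begin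
  crossings (chain t) (embed b r , embed b s)           ≤⟨ Unique-⊆-length (Unique.filter⁺ cross? (edges-unique (chain t))) sub ⟩
  length (map (embedEdge b) (K₃,₃-crossing (r , s)))    ≡⟨ length-map (embedEdge b) (K₃,₃-crossing (r , s)) ⟩
  length (K₃,₃-crossing (r , s))                        ≤⟨ K₃,₃-4-planar r s ⟩
  4                                                     ∎
  where
  open ≤-Reasoning
  cross? = crosses? (embed b r , embed b s)

  sub : filter cross? (edges (chain t)) ⊆ map (embedEdge b) (K₃,₃-crossing (r , s))
  sub f∈ with f∈edges , cr ← ∈-filter⁻ cross? {xs = edges (chain t)} f∈
    with c , r′ , s′ , refl , refl ← ∈-edges⁻ (chain t) f∈edges
    with refl , cr′ ← crossing-in-block (r , s) (r′ , s′) cr =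
    ∈-map⁺ (embedEdge b) (∈-K₃,₃-crossing (r , s) (r′ , s′) cr′)

-- Counting the edges of the chain

-- The nine pairs are numbered lexicographically, so suc skips (0F , 0F), the edge
-- that a block has in common with the previous one.
newEdge : Fin 8 → Fin 3 × Fin 3
newEdge k = remQuot 3 (suc k)

newEdge-injective : ∀ {k l} → newEdge k ≡ newEdge l → k ≡ l
newEdge-injective {k} {l} eq = Fin.suc-injective (trans (sym (combine-remQuot {3} 3 (suc k)))
  (trans (cong (uncurry combine) eq) (combine-remQuot {3} 3 (suc l))))

-- `combine` sends `(0F , 0F)` to zero, but sends `newEdge k` back to `suc k`.
newEdge-≢ : ∀ k {r s} → newEdge k ≡ (r , s) → r ≡ 0F → s ≢ 0F
newEdge-≢ k eq refl refl with () ← trans (sym (combine-remQuot {3} 3 (suc k))) (cong (uncurry combine) eq)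

pair-cases : ∀ e → e ≡ (0F , 0F) ⊎ ∃[ k ] e ≡ newEdge k
pair-cases (r , s) with combine r s | remQuot-combine r s
... | zero  | eq = inj₁ (sym eq)
... | suc k | eq = inj₂ (k , sym eq)

blockEdge : ∀ {t} → Fin t × Fin 8 → Fin (suc (t * 2)) × Fin (suc (t * 2))
blockEdge (b , k) = embedEdge b (newEdge k)

-- A common edge would have to be the first edge of the later block, which `newEdge` skips.
blockEdge-disjoint : ∀ {t} {b c : Fin t} → b Fin.< c → ∀ k l → blockEdge (b , k) ≢ blockEdge (c , l)
blockEdge-disjoint b<c k l eq with eq₁ , eq₂ ← ,-injective eq =
  newEdge-≢ l refl (embed-overlap b<c eq₁) (embed-overlap b<c eq₂)

blockEdge-injective : ∀ {t} {x y : Fin t × Fin 8} → blockEdge x ≡ blockEdge y → x ≡ y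
blockEdge-injective {x = b , k} {c , l} eq with Fin.<-cmp b c
... | tri< b<c _ _ = contradiction eq (blockEdge-disjoint b<c k l)
... | tri> _ _ c<b = contradiction (sym eq) (blockEdge-disjoint c<b l k)
... | tri≈ _ refl _ with eq₁ , eq₂ ← ,-injective eq =
  cong (b ,_) (newEdge-injective (cong₂ _,_ (embed-injective b eq₁) (embed-injective b eq₂)))

blockEdge-nonzero : ∀ {t} (x : Fin t × Fin 8) → (zero , zero) ≢ blockEdge x
blockEdge-nonzero (b , k) eq with eq₁ , eq₂ ← ,-injective eq =
  newEdge-≢ k refl (embed-zero b (sym eq₁)) (embed-zero b (sym eq₂))

chainEdges : ∀ t → List (Fin (suc (t * 2)) × Fin (suc (t * 2)))
chainEdges t = (zero , zero) ∷ map blockEdge (cartesianProduct (allFin t) (allFin 8))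

chainEdges-unique : ∀ t → Unique (chainEdges t)
chainEdges-unique t =
  All.tabulate (λ e∈ eq → let x , _ , eq′ = ∈-map⁻ blockEdge e∈ in blockEdge-nonzero x (trans eq eq′))
  ∷ Unique.map⁺ blockEdge-injective (allPairs-unique t 8)

edges⊆chainEdges : ∀ t → edges (chain t) ⊆ chainEdges t
edges⊆chainEdges t e∈ with b , r , s , refl , refl ← ∈-edges⁻ (chain t) e∈ = cover b (pair-cases (r , s))
  where
  cover : ∀ {t} {e} (b : Fin t) → e ≡ (0F , 0F) ⊎ ∃[ k ] e ≡ newEdge k → embedEdge b e ∈ chainEdges t
  cover b       (inj₂ (k , refl)) = there (∈-map⁺ blockEdge (∈-allPairs (b , k)))
  cover zero    (inj₁ refl)       = here (sym (cong₂ _,_ embed-origin embed-origin))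
  -- The first edge of a later block is the last edge of its predecessor, and `newEdge 7F` is
  -- `(2F , 2F)`.
  cover (suc b) (inj₁ refl)
    rewrite embed-shared b = there (∈-map⁺ blockEdge (∈-allPairs (inject₁ b , 7F)))

-- At least one block is required: `chain 0` has no edges, whereas `chainEdges 0` still lists
-- `(zero , zero)`.
chainEdges⊆edges : ∀ t → chainEdges (suc t) ⊆ edges (chain (suc t))
chainEdges⊆edges t (here refl) = ∈-edges⁺ (chain (suc t)) (zero , 0F , 0F , embed-origin , embed-origin)
chainEdges⊆edges t (there e∈) with (b , k) , _ , refl ← ∈-map⁻ blockEdge {xs = cartesianProduct (allFin (suc t)) (allFin 8)} e∈ =
  ∈-edges⁺ (chain (suc t)) (b , proj₁ (newEdge k) , proj₂ (newEdge k) , refl , refl)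

size-chain : ∀ t → size (underlying (chain (suc t))) ≡ 1 + suc t * 8
size-chain t = begin
  size (underlying (chain (suc t)))   ≡⟨ size-underlying (chain (suc t)) ⟩
  length (edges (chain (suc t)))      ≡⟨ ≤-antisym (Unique-⊆-length (edges-unique (chain (suc t))) (edges⊆chainEdges (suc t)))
                                                   (Unique-⊆-length (chainEdges-unique (suc t)) (chainEdges⊆edges t)) ⟩
  length (chainEdges (suc t))         ≡⟨ cong suc (length-map blockEdge (cartesianProduct (allFin (suc t)) (allFin 8))) ⟩
  suc (length (cartesianProduct (allFin (suc t)) (allFin 8))) ≡⟨ cong suc (length-allPairs (suc t) 8) ⟩
  1 + suc t * 8                       ∎
  where open ≡-Reasoning

theorem5 : ∀ (m : ℕ) → ∃[ n ] (m < n × (Σ[ G ∈ Graph n ] (TwoLayerKPlanar 4 G × size G + 3 ≡ 2 * n)))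
theorem5 m =
  -- With m + 1 blocks there are n = 4(m + 1) + 2 vertices, more than m, and 8(m + 1) + 1 = 2n - 3
  -- edges.
  _ , m<n , underlying (chain (suc m)) ,
  (chain (suc m) , chain-4-planar (suc m) , ≅-refl _) ,
  trans (cong (_+ 3) (size-chain m)) (count m)
  where
  m<n : m < suc (suc m * 2) + suc (suc m * 2)
  m<n = s≤s (≤-trans (≤-trans (ℕ.n≤1+n m) (ℕ.m≤m*n (suc m) 2)) (ℕ.m≤m+n _ _))

  count : ∀ k → 1 + suc k * 8 + 3 ≡ 2 * (suc (suc k * 2) + suc (suc k * 2))
  count = solve-∀
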